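{- Let $T$ be a tree of order $n$ (i.e. with $n$ vertices). Then $h(T)\leq \lceil \tfrac12\log_2(n)\rceil$.
   Context: The game: on a finite graph $G$, an invisible mouse and a team of $r$ cats ($r \ge 0$) play as follows. In round $i=1,2,\dots$ the mouse is at some vertex $v_i$, where $v_1$ is arbitrary and for $i\ge 2$ the vertex $v_i$ must be adjacent to $v_{i-1}$ (the mouse must move at every turn). Then each cat chooses any vertex of $G$ (cats are not constrained to move along edges); the mouse is caught in round $i$ if some cat chooses $v_i$. The cats never see the mouse, so a strategy for $r$ cats is a sequence $C_1,C_2,\dots$ of subsets of $V(G)$, each of size at most $r$, and the mouse evades it indefinitely if there is an infinite sequence of vertices $v_1,v_2,\dots$ with $v_i$ adjacent to $v_{i+1}$ and $v_i\notin C_i$ for all $i\ge 1$. The graph $G$ is an $r$-cat-win if some strategy for $r$ cats cannot be evaded indefinitely (equivalently, for finite $G$: there is a finite sequence $C_1,\dots,C_t$ of sets of size at most $r$ such that every walk $v_1,\dots,v_t$ in $G$ has $v_i\in C_i$ for some $i$); otherwise $G$ is an $r$-mouse-win. $h(G)$ denotes the least integer $r$ such that $G$ is an $r$-cat-win. -}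

module Defs where

open import Axiom.ExcludedMiddle using (ExcludedMiddle)
open import Data.Bool.Base using (true)
open import Data.Empty using (⊥-elim) renaming (⊥ to Empty)
open import Data.Fin.Base using (Fin; zero; suc; fromℕ; inject₁)
open import Data.Fin.Properties using (any?)
open import Data.Fin.Subset
  using (Subset; inside; outside; ∣_∣; _∈_; _∉_; _⊆_; ⊥; ⊤)
open import Data.Fin.Subset.Properties
  using (_∈?_; _⊆?_; anySubset?; ∈⊤; ∣⊤∣≡n; ∣⊥∣≡0)
open import Data.Nat.Base
  using (ℕ; zero; suc; _+_; _^_; _⊔_; _≤_; _<_; z≤n; s≤s)
open import Data.Nat.Properties
  using (_≟_; _≤?_; ≤-refl; ≤-reflexive; ≤-trans; <-≤-trans; <-irrefl; n≤1+n;
         m≤m+n; +-suc; +-identityʳ; +-mono-≤; +-mono-<-≤; +-mono-≤-<;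
         +-monoʳ-≤; m≤m⊔n; m≤n⊔m)
open import Data.Product.Base using (Σ; ∃; _×_; _,_; proj₁; proj₂)
open import Data.Sum.Base using (_⊎_; inj₁; inj₂)
open import Data.Unit.Base using (tt) renaming (⊤ to Unit)
open import Data.Vec.Base using (Vec; []; _∷_; head; lookup; tabulate)
open import Data.Vec.Properties
  using (lookup∘tabulate; lookup⇒[]=; []=⇒lookup)
open import Data.Vec.Relation.Unary.All using (All; []; _∷_)
open import Data.Vec.Relation.Unary.Linked using (Linked; []; [-]; _∷_)
open import Function.Base using (_∘_)
open import Function.Definitions using (Injective)
open import Level using (0ℓ)
open import Relation.Binary.Construct.Closure.ReflexiveTransitive using (Star)
open import Relation.Binary.Core using (Rel)
import Relation.Binary.Definitions as B
open import Relation.Binary.PropositionalEquality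
  using (_≡_; refl; sym; trans; subst)
open import Relation.Nullary
  using (¬_; Dec; yes; no; does; ¬?; _×-dec_; _⊎-dec_; contradiction)
open import Relation.Nullary.Decidable using (map′; dec-true; decidable-stable)
open import Relation.Unary using (Pred; Decidable)

record Graph (n : ℕ) : Set₁ where
  infix 4 _~_ _~?_
  field
    _~_      : Rel (Fin n) 0ℓ
    ~-sym    : B.Symmetric _~_
    ~-irrefl : B.Irreflexive _≡_ _~_
    _~?_     : B.Decidable _~_

record Cycle {n : ℕ} (G : Graph n) : Set where
  open Graph G
  field
    k         : ℕ
    vertex    : Fin (3 + k) → Fin n
    injective : Injective _≡_ _≡_ vertex
    step      : ∀ (i : Fin (2 + k)) → vertex (inject₁ i) ~ vertex (suc i)
    close     : vertex (fromℕ (2 + k)) ~ vertex zero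

record IsTree {n : ℕ} (G : Graph n) : Set where
  open Graph G
  field
    nonempty  : Fin n
    connected : ∀ u v → Star _~_ u v
    acyclic   : ¬ Cycle G

module _ {n : ℕ} (G : Graph n) where
  open Graph G

  Catches : ∀ {t} → Vec (Subset n) t → Set
  Catches {t} C =
    ∀ (v : Vec (Fin n) t) → Linked _~_ v → ∃ λ i → lookup v i ∈ lookup C i

  CatWin : ℕ → Set
  CatWin r = ∃ λ t → Σ (Vec (Subset n) t) λ C →
    All (λ S → ∣ S ∣ ≤ r) C × Catches C

  -- CatWin is the finite form of the winning condition, CatWin∞ the one with
  -- infinite play.  They agree on finite graphs: CatWin⇒CatWin∞ below, and
  -- CatWin∞⇒CatWin, a compactness argument proved from excluded middle.  The
  -- finite form is the one that is decidable, so that h can be a function.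
  Evades : (ℕ → Subset n) → (ℕ → Fin n) → Set
  Evades C v = (∀ i → v i ~ v (suc i)) × (∀ i → v i ∉ C i)

  CatWin∞ : ℕ → Set
  CatWin∞ r = Σ (ℕ → Subset n) λ C → (∀ i → ∣ C i ∣ ≤ r) × ¬ ∃ (Evades C)

IsLeast : (ℕ → Set) → ℕ → Set
IsLeast P m = P m × (∀ k → P k → m ≤ k)

least : ∀ {P : ℕ → Set} → Decidable P → ∀ m → P m → ∃ (IsLeast P)
least P? zero    p = zero , p , λ _ _ → z≤n
least P? (suc m) p with P? zero
... | yes p₀ = zero , p₀ , λ _ _ → z≤n
... | no ¬p₀ with least (P? ∘ suc) m p
...   | k , pk , min = suc k , pk , λ
        { zero    p₀ → contradiction p₀ ¬p₀
        ; (suc j) pj → s≤s (min j pj) }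

count : ∀ {n} {P : Pred (Subset n) 0ℓ} → Decidable P → ℕ
count {zero}  P? with P? []
... | yes _ = 1
... | no  _ = 0
count {suc n} P? = count (P? ∘ (inside ∷_)) + count (P? ∘ (outside ∷_))

count≤2^n : ∀ {n} {P : Pred (Subset n) 0ℓ} (P? : Decidable P) →
            count P? ≤ 2 ^ n
count≤2^n {zero}  P? with P? []
... | yes _ = ≤-refl
... | no  _ = z≤n
count≤2^n {suc n} P? = +-mono-≤ (count≤2^n (P? ∘ (inside ∷_)))
  (subst (count (P? ∘ (outside ∷_)) ≤_) (sym (+-identityʳ (2 ^ n)))
    (count≤2^n (P? ∘ (outside ∷_))))

count-mono-≤ : ∀ {n} {P Q : Pred (Subset n) 0ℓ}
               (P? : Decidable P) (Q? : Decidable Q) →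
               (∀ S → P S → Q S) → count P? ≤ count Q?
count-mono-≤ {zero} P? Q? f with P? [] | Q? []
... | yes _ | yes _ = ≤-refl
... | yes p | no ¬q = contradiction (f [] p) ¬q
... | no  _ | _     = z≤n
count-mono-≤ {suc n} P? Q? f = +-mono-≤
  (count-mono-≤ (P? ∘ (inside ∷_)) (Q? ∘ (inside ∷_)) (f ∘ (inside ∷_)))
  (count-mono-≤ (P? ∘ (outside ∷_)) (Q? ∘ (outside ∷_)) (f ∘ (outside ∷_)))

count-mono-< : ∀ {n} {P Q : Pred (Subset n) 0ℓ}
               (P? : Decidable P) (Q? : Decidable Q) →
               (∀ S → P S → Q S) → ∀ S → Q S → ¬ P S → count P? < count Q?
count-mono-< {zero} P? Q? f [] q ¬p with P? [] | Q? []
... | yes p | _     = contradiction p ¬p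
... | no  _ | yes _ = ≤-refl
... | no  _ | no ¬q = contradiction q ¬q
count-mono-< {suc n} P? Q? f (inside ∷ S) q ¬p = +-mono-<-≤
  (count-mono-< (P? ∘ (inside ∷_)) (Q? ∘ (inside ∷_)) (f ∘ (inside ∷_)) S q ¬p)
  (count-mono-≤ (P? ∘ (outside ∷_)) (Q? ∘ (outside ∷_)) (f ∘ (outside ∷_)))
count-mono-< {suc n} P? Q? f (outside ∷ S) q ¬p = +-mono-≤-<
  (count-mono-≤ (P? ∘ (inside ∷_)) (Q? ∘ (inside ∷_)) (f ∘ (inside ∷_)))
  (count-mono-< (P? ∘ (outside ∷_)) (Q? ∘ (outside ∷_)) (f ∘ (outside ∷_))
    S q ¬p)

module _ {n : ℕ} {P : Pred (Fin n) 0ℓ} (P? : Decidable P) where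

  comprehension : Subset n
  comprehension = tabulate (does ∘ P?)

  ∈-comprehension⁺ : ∀ {x} → P x → x ∈ comprehension
  ∈-comprehension⁺ {x} p = lookup⇒[]= x comprehension
    (trans (lookup∘tabulate (does ∘ P?) x) (dec-true (P? x) p))

  ∈-comprehension⁻ : ∀ {x} → x ∈ comprehension → P x
  ∈-comprehension⁻ {x} x∈ = from (P? x)
    (trans (sym (lookup∘tabulate (does ∘ P?) x)) ([]=⇒lookup x∈))
    where
    from : (d : Dec (P x)) → does d ≡ true → P x
    from (yes p) _ = p

module _ {n : ℕ} (G : Graph n) where
  open Graph G

  -- The possible positions of the mouse after its next move, if it is
  -- known to be in S and has just evaded C.
  Next : (S C : Subset n) → Pred (Fin n) 0ℓ
  Next S C y = ∃ λ x → (x ∈ S × x ∉ C) × x ~ y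

  Next? : ∀ S C → Decidable (Next S C)
  Next? S C y = any? λ x → ((x ∈? S) ×-dec ¬? (x ∈? C)) ×-dec (x ~? y)

  next : (S C : Subset n) → Subset n
  next S C = comprehension (Next? S C)

  -- r cats can catch, within k rounds, a mouse known to be in S.
  WinsWithin : ℕ → ℕ → Pred (Subset n) 0ℓ
  WinsWithin r zero    S = Empty
  WinsWithin r (suc k) S =
    ∃ λ C → ∣ C ∣ ≤ r × (S ⊆ C ⊎ WinsWithin r k (next S C))

  WinsWithin? : ∀ r k → Decidable (WinsWithin r k)
  WinsWithin? r zero    S = no λ ()
  WinsWithin? r (suc k) S = anySubset? λ C →
    (∣ C ∣ ≤? r) ×-dec ((S ⊆? C) ⊎-dec WinsWithin? r k (next S C))

  WinsWithin-suc : ∀ r k S → WinsWithin r k S → WinsWithin r (suc k) S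
  WinsWithin-suc r (suc k) S (C , b , inj₁ S⊆C) = C , b , inj₁ S⊆C
  WinsWithin-suc r (suc k) S (C , b , inj₂ w)   =
    C , b , inj₂ (WinsWithin-suc r k (next S C) w)

  Stable : ℕ → ℕ → Set
  Stable r k = ∀ S → WinsWithin r (suc k) S → WinsWithin r k S

  -- Otherwise the number of winning S would grow at every step, beyond 2 ^ n.
  stable : ∀ r → ∃ (Stable r)
  stable r = go (suc (2 ^ n)) 0 (m≤m+n (suc (2 ^ n)) _)
    where
    go : ∀ fuel k → 2 ^ n < fuel + count (WinsWithin? r k) → ∃ (Stable r)
    go zero k lt = contradiction
      (<-≤-trans lt (count≤2^n (WinsWithin? r k))) (<-irrefl refl)
    go (suc fuel) k lt
      with anySubset?
             (λ S → WinsWithin? r (suc k) S ×-dec ¬? (WinsWithin? r k S))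
    ... | yes (S , w , ¬w) = go fuel (suc k) (<-≤-trans lt
      (≤-trans (≤-reflexive (sym (+-suc fuel (count (WinsWithin? r k)))))
               (+-monoʳ-≤ fuel (count-mono-< (WinsWithin? r k)
                 (WinsWithin? r (suc k)) (WinsWithin-suc r k) S w ¬w))))
    ... | no none = k , λ S w →
      decidable-stable (WinsWithin? r k S) λ ¬w → none (S , w , ¬w)

  Stable-bound : ∀ r k → Stable r k → ∀ j S →
                 WinsWithin r j S → WinsWithin r k S
  Stable-bound r k st (suc j) S (C , b , inj₁ S⊆C) =
    st S (C , b , inj₁ S⊆C)
  Stable-bound r k st (suc j) S (C , b , inj₂ w) =
    st S (C , b , inj₂ (Stable-bound r k st j (next S C) w))

  StartsIn : ∀ {t} → Subset n → Vec (Fin n) t → Set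
  StartsIn S []      = Unit
  StartsIn S (x ∷ _) = x ∈ S

  CatchesFrom : ∀ {t} → Subset n → Vec (Subset n) t → Set
  CatchesFrom {t} S C = ∀ (v : Vec (Fin n) t) → StartsIn S v → Linked _~_ v →
    ∃ λ i → lookup v i ∈ lookup C i

  CatchesFrom⇒WinsWithin : ∀ {r t} S (C : Vec (Subset n) t) →
    All (λ D → ∣ D ∣ ≤ r) C → CatchesFrom S C → WinsWithin r t S
  CatchesFrom⇒WinsWithin S [] [] c with c [] tt []
  ... | () , _
  CatchesFrom⇒WinsWithin S (D ∷ C) (b ∷ bs) c with S ⊆? D
  ... | yes S⊆D = D , b , inj₁ S⊆D
  ... | no  S⊈D = D , b , inj₂ (CatchesFrom⇒WinsWithin (next S D) C bs c′)
    where
    c′ : CatchesFrom (next S D) C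
    c′ [] _ [] = ⊥-elim (S⊈D S⊆D)
      where
      S⊆D : S ⊆ D
      S⊆D {x} x∈S with c (x ∷ []) x∈S [-]
      ... | zero , x∈D = x∈D
    c′ (y ∷ w) y∈ l with ∈-comprehension⁻ (Next? S D) y∈
    ... | x , (x∈S , x∉D) , x~y with c (x ∷ y ∷ w) x∈S (x~y ∷ l)
    ...   | zero  , x∈D = contradiction x∈D x∉D
    ...   | suc i , p   = i , p

  WinsWithin⇒CatchesFrom : ∀ {r} k S → WinsWithin r k S →
    ∃ λ t → Σ (Vec (Subset n) (suc t)) λ C →
      All (λ D → ∣ D ∣ ≤ r) C × CatchesFrom S C
  WinsWithin⇒CatchesFrom (suc k) S (D , b , inj₁ S⊆D) =
    0 , D ∷ [] , b ∷ [] , λ { (x ∷ []) x∈S _ → zero , S⊆D x∈S }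
  WinsWithin⇒CatchesFrom (suc k) S (D , b , inj₂ w)
    with WinsWithin⇒CatchesFrom k (next S D) w
  ... | t , C , bs , c = suc t , D ∷ C , b ∷ bs , c′
    where
    c′ : CatchesFrom S (D ∷ C)
    c′ (x ∷ y ∷ v) x∈S (x~y ∷ l) with x ∈? D
    ... | yes x∈D = zero , x∈D
    ... | no  x∉D
      with c (y ∷ v) (∈-comprehension⁺ (Next? S D) (x , (x∈S , x∉D) , x~y)) l
    ...   | i , p = suc i , p

  CatWin? : Decidable (CatWin G)
  CatWin? r = map′ to from (WinsWithin? r (proj₁ (stable r)) ⊤)
    where
    to : WinsWithin r (proj₁ (stable r)) ⊤ → CatWin G r
    to w with WinsWithin⇒CatchesFrom _ ⊤ w
    ... | t , C , bs , c =
      suc t , C , bs , λ { (x ∷ v) l → c (x ∷ v) ∈⊤ l }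

    from : CatWin G r → WinsWithin r (proj₁ (stable r)) ⊤
    from (t , C , bs , c) = Stable-bound r _ (proj₂ (stable r)) t ⊤
      (CatchesFrom⇒WinsWithin ⊤ C bs λ v _ l → c v l)

  CatWin-order : CatWin G n
  CatWin-order = 1 , ⊤ ∷ [] , ≤-reflexive (∣⊤∣≡n n) ∷ [] ,
    λ { (x ∷ []) _ → zero , ∈⊤ }

  leastCatWin : ∃ (IsLeast (CatWin G))
  leastCatWin = least CatWin? n CatWin-order

h : ∀ {n} → Graph n → ℕ
h G = proj₁ (leastCatWin G)

h-isLeast : ∀ {n} (G : Graph n) → IsLeast (CatWin G) (h G)
h-isLeast G = proj₂ (leastCatWin G)

module _ {n : ℕ} (G : Graph n) where
  open Graph G

  pad : ∀ {t} → Vec (Subset n) t → ℕ → Subset n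
  pad []      _       = ⊥
  pad (D ∷ C) zero    = D
  pad (D ∷ C) (suc i) = pad C i

  CatWin⇒CatWin∞ : ∀ {r} → CatWin G r → CatWin∞ G r
  CatWin⇒CatWin∞ {r} (t , C , bs , c) = pad C , bounded C bs , λ
    { (v , l , e) → not-caught C v e (c (prefix t v) (prefix-linked t v l)) }
    where
    bounded : ∀ {t} (C : Vec (Subset n) t) → All (λ S → ∣ S ∣ ≤ r) C →
              ∀ i → ∣ pad C i ∣ ≤ r
    bounded []      []       _       = subst (_≤ r) (sym (∣⊥∣≡0 n)) z≤n
    bounded (D ∷ C) (b ∷ bs) zero    = b
    bounded (D ∷ C) (b ∷ bs) (suc i) = bounded C bs i

    prefix : ∀ t → (ℕ → Fin n) → Vec (Fin n) t
    prefix zero    v = []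
    prefix (suc t) v = v 0 ∷ prefix t (v ∘ suc)

    prefix-linked : ∀ t v → (∀ i → v i ~ v (suc i)) → Linked _~_ (prefix t v)
    prefix-linked zero          v l = []
    prefix-linked (suc zero)    v l = [-]
    prefix-linked (suc (suc t)) v l =
      l 0 ∷ prefix-linked (suc t) (v ∘ suc) (l ∘ suc)

    not-caught : ∀ {t} (C : Vec (Subset n) t) v → (∀ i → v i ∉ pad C i) →
                 ¬ ∃ λ i → lookup (prefix t v) i ∈ lookup C i
    not-caught (D ∷ C) v e (zero  , p) = e 0 p
    not-caught (D ∷ C) v e (suc i , p) =
      not-caught C (v ∘ suc) (e ∘ suc) (i , p)

  -- The mouse, being at x in round i, can evade C for t rounds from round i on.
  Survives : (ℕ → Subset n) → ℕ → ℕ → Pred (Fin n) 0ℓ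
  Survives C zero    i x = Unit
  Survives C (suc t) i x =
    x ∉ C i × (t ≡ 0 ⊎ ∃ λ y → x ~ y × Survives C t (suc i) y)

  Survives? : ∀ C t i → Decidable (Survives C t i)
  Survives? C zero    i x = yes tt
  Survives? C (suc t) i x = ¬? (x ∈? C i) ×-dec
    ((t ≟ 0) ⊎-dec any? λ y → (x ~? y) ×-dec Survives? C t (suc i) y)

  Survives-antitone : ∀ C {s t} → s ≤ t → ∀ i x →
                      Survives C t i x → Survives C s i x
  Survives-antitone C z≤n i x sv = tt
  Survives-antitone C (s≤s z≤n) i x (x∉ , _) = x∉ , inj₁ refl
  Survives-antitone C (s≤s (s≤s s≤t)) i x (x∉ , inj₂ (y , x~y , sv)) =
    x∉ , inj₂ (y , x~y , Survives-antitone C (s≤s s≤t) (suc i) y sv)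

  uniform : ∀ {m} {P : ℕ → Fin m → Set} →
            (∀ {s t} → s ≤ t → ∀ y → P s y → P t y) →
            (∀ y → ∃ λ t → P t y) → ∃ λ t → ∀ y → P t y
  uniform {zero}  mono f = 0 , λ ()
  uniform {suc m} mono f
    with f zero | uniform (λ le y → mono le (suc y)) (f ∘ suc)
  ... | s , p | t , q = s ⊔ t , λ
    { zero    → mono (m≤m⊔n s t) zero p
    ; (suc y) → mono (m≤n⊔m s t) (suc y) (q y) }

  CatWin∞⇒CatWin : ExcludedMiddle 0ℓ → ∀ {r} → CatWin∞ G r → CatWin G r
  CatWin∞⇒CatWin em {r} (C , b , none) with CatWin? G r
  ... | yes w = w
  ... | no ¬w = contradiction (walk , walk-adj , walk-evades) none
    where
    Immortal : ℕ → Pred (Fin n) 0ℓ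
    Immortal i x = ∀ t → Survives C t i x

    not-immortal : ∀ i x → ¬ Immortal i x → ∃ λ t → ¬ Survives C t i x
    not-immortal i x ¬imm with em {∃ λ t → ¬ Survives C t i x}
    ... | yes p = p
    ... | no ¬p = contradiction
      (λ t → decidable-stable (Survives? C t i x) λ ¬s → ¬p (t , ¬s)) ¬imm

    -- König's lemma, one step.
    compact : ∀ (Q : Pred (Fin n) 0ℓ) i →
              (∀ t → ∃ λ y → Q y × Survives C t i y) →
              ∃ λ y → Q y × Immortal i y
    compact Q i f with em {∃ λ y → Q y × Immortal i y}
    ... | yes p = p
    ... | no ¬p with uniform {P = λ t y → ¬ (Q y × Survives C t i y)}
            (λ le y ¬qs (q , s) → ¬qs (q , Survives-antitone C le i y s)) dies
      where
      dies : ∀ y → ∃ λ t → ¬ (Q y × Survives C t i y)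
      dies y with em {Q y}
      ... | no ¬q = 0 , λ (q , _) → ¬q q
      ... | yes q with not-immortal i y (λ imm → ¬p (y , q , imm))
      ...   | t , ¬s = t , λ (_ , s) → ¬s s
    ...   | t , dead with f t
    ...     | y , qs = contradiction qs (dead y)

    successor : ∀ i x → Immortal i x → ∃ λ y → x ~ y × Immortal (suc i) y
    successor i x imm = compact (x ~_) (suc i) moves
      where
      moves : ∀ t → ∃ λ y → x ~ y × Survives C t (suc i) y
      moves zero with imm 2
      ... | _ , inj₂ (y , x~y , _) = y , x~y , tt
      moves (suc t) with imm (suc (suc t))
      ... | _ , inj₂ p = p

    schedule : ∀ t → ℕ → Vec (Subset n) t
    schedule zero    i = []
    schedule (suc t) i = C i ∷ schedule t (suc i)

    scheduled : ∀ t i → All (λ S → ∣ S ∣ ≤ r) (schedule t i)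
    scheduled zero    i = []
    scheduled (suc t) i = b i ∷ scheduled t (suc i)

    caught : ∀ t i (v : Vec (Fin n) (suc t)) → Linked _~_ v →
             ¬ Survives C (suc t) i (head v) →
             ∃ λ j → lookup v j ∈ lookup (schedule (suc t) i) j
    caught t i (x ∷ v) l ¬s with x ∈? C i
    ... | yes x∈ = zero , x∈
    caught zero    i (x ∷ [])    [-]       ¬s | no x∉ =
      contradiction (x∉ , inj₁ refl) ¬s
    caught (suc t) i (x ∷ y ∷ v) (x~y ∷ l) ¬s | no x∉
      with caught t (suc i) (y ∷ v) l
             (λ s → ¬s (x∉ , inj₂ (y , x~y , s)))
    ... | j , p = suc j , p

    survivor : ∀ t → ∃ λ x → Unit × Survives C (suc t) 0 x
    survivor t with any? (Survives? C (suc t) 0)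
    ... | yes (x , s) = x , tt , s
    ... | no ¬s = contradiction
      (suc t , schedule (suc t) 0 , scheduled (suc t) 0 ,
        λ v l → caught t 0 v l λ s → ¬s (head v , s)) ¬w

    start : ∃ λ x → Unit × Immortal 0 x
    start = compact (λ _ → Unit) 0 λ t →
      let x , _ , s = survivor t
      in x , tt , Survives-antitone C (n≤1+n t) 0 x s

    state : ∀ i → ∃ (Immortal i)
    state zero    = proj₁ start , proj₂ (proj₂ start)
    state (suc i) =
      let x , imm = state i
          y , _ , imm′ = successor i x imm
      in y , imm′

    walk : ℕ → Fin n
    walk i = proj₁ (state i)

    walk-adj : ∀ i → walk i ~ walk (suc i)
    walk-adj i = proj₁ (proj₂ (successor i (walk i) (proj₂ (state i))))

    walk-evades : ∀ i → walk i ∉ C i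
    walk-evades i = proj₁ (proj₂ (state i) 1)

{-# OPTIONS --safe #-}

-- A guard that checks a vertex v whenever the mouse may be there confines the
-- mouse to one component of T − v, and by bipartiteness it is needed only in the
-- rounds of the colour of v.  So count the cats of the two colours separately and
-- let R be the region in which the mouse is known to stay.  With
-- M = (4ʳ − 1) / 3, by a joint induction on r:
--   r + r cats win if |R| ≤ 3M + 1 = 4ʳ, and
--   r + (r + 1) cats win, for either choice of colours, if |R| ≤ 4M + 1.
-- Call a side of an edge heavy if it contains more than M vertices of R, and
-- take an inclusion-minimal heavy side, that containing p of an edge qp.  For the
-- second claim, one of p and q has the richer colour or cuts R into small enough
-- pieces.  For the first, start with a guard at p and move it into the other side
-- of qp, which has at most 2M vertices of R: at every vertex, all branches but the
-- one behind and at most one ahead are light, the light ones are cleaned by the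
-- remaining cats (the second claim for r − 1), and the guard moves on.

module Submission where

open import Defs
open import Data.Nat using (ℕ; _≤_; ⌈_/2⌉)
open import Data.Nat.Logarithm using (⌈log₂_⌉)

open import Data.Bool.Base using (Bool; true; false; not; _∨_; _xor_; if_then_else_)
import Data.Bool.Properties as Bool
open import Data.Fin.Base using (Fin; zero; suc; fromℕ; inject₁)
import Data.Fin.Properties as F
open import Data.Fin.Subset
  using (Subset; inside; outside; _∈_; _∉_; _⊆_; _∩_; _∪_; ∣_∣; ⁅_⁆; ⊥; ⊤)
open import Data.Fin.Subset.Properties
open import Data.List.Base using (List; []; _∷_; _++_; map; allFin; length)
open import Data.List.Membership.Propositional using () renaming (_∈_ to _∈ˡ_)
open import Data.List.Membership.Propositional.Properties using (∈-allFin)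
open import Data.List.Relation.Unary.All as All using (All; []; _∷_)
import Data.List.Relation.Unary.All.Properties as All
open import Data.List.Relation.Unary.Any using (here; there)
open import Data.Nat.Base using (zero; suc; z≤n; s≤s; _+_; _*_; _^_; _<_)
open import Data.Nat.Logarithm.Core using (⌈log2⌉)
import Data.Nat.Properties as ℕ
open import Data.Nat.Solver using (module +-*-Solver)
open import Data.Product.Base using (∃; ∃₂; _×_; _,_; proj₁; proj₂)
open import Data.Sum.Base using (_⊎_; inj₁; inj₂; [_,_]′)
open import Data.Vec.Base as Vec using (Vec; []; _∷_; lookup; here; there)
import Data.Vec.Membership.DecPropositional as DecMembership
open import Data.Vec.Membership.Propositional using () renaming (_∈_ to _∈ᵛ_; _∉_ to _∉ᵛ_)
open import Data.Vec.Relation.Unary.All as VecAll using ([]; _∷_)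
import Data.Vec.Relation.Unary.All.Properties as VecAll
open import Data.Vec.Relation.Unary.AllPairs using ([]; _∷_)
open import Data.Vec.Relation.Unary.Any using (here; there)
open import Data.Vec.Relation.Unary.Linked using (Linked; _∷_)
open import Data.Vec.Relation.Unary.Unique.Propositional using (Unique)
open import Data.Vec.Relation.Unary.Unique.Propositional.Properties using (lookup-injective)
open import Function.Base using (_∘_; const; case_of_)
open import Induction.WellFounded using (acc)
open import Level using (0ℓ)
open import Relation.Binary.Construct.Closure.ReflexiveTransitive
  using (Star; ε; _◅_; _◅◅_; reverse)
open import Relation.Binary.Core using (Rel)
open import Relation.Binary.PropositionalEquality
open import Relation.Nullary using (¬_; Dec; yes; no; does; contradiction; ¬?; _×-dec_)
open import Relation.Nullary.Decidable using (dec-true; dec-false; decidable-stable)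

-- Parities, cardinalities, budgets and numerical bounds.

∉⇒All≢ : ∀ {a} {A : Set a} {x : A} {k} {xs : Vec A k} → x ∉ᵛ xs → VecAll.All (x ≢_) xs
∉⇒All≢ {xs = []}    _  = []
∉⇒All≢ {xs = _ ∷ _} x∉ = x∉ ∘ here ∷ ∉⇒All≢ (x∉ ∘ there)

parity : ∀ {n} → (Fin n → Bool) → Bool
parity {zero}  f = false
parity {suc n} f = f zero xor parity (f ∘ suc)

parity-cong : ∀ {n} {f g : Fin n → Bool} → (∀ i → f i ≡ g i) → parity f ≡ parity g
parity-cong {zero}  eq = refl
parity-cong {suc n} eq = cong₂ _xor_ (eq zero) (parity-cong (eq ∘ suc))

parity-flip : ∀ {n} {f g : Fin n → Bool} i → f i ≡ not (g i) →
              (∀ j → j ≢ i → f j ≡ g j) → parity f ≡ not (parity g)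
parity-flip {f = f} {g} zero flip same =
  trans (cong₂ _xor_ flip (parity-cong λ j → same (suc j) λ ()))
        (sym (Bool.not-distribˡ-xor (g zero) _))
parity-flip {f = f} {g} (suc i) flip same =
  trans (cong₂ _xor_ (same zero λ ())
           (parity-flip i flip λ j j≢i → same (suc j) (j≢i ∘ F.suc-injective)))
        (sym (Bool.not-distribʳ-xor (g zero) _))

∣p∪q∣≤∣p∣+∣q∣ : ∀ {n} (p q : Subset n) → ∣ p ∪ q ∣ ≤ ∣ p ∣ + ∣ q ∣
∣p∪q∣≤∣p∣+∣q∣ []            []            = z≤n
∣p∪q∣≤∣p∣+∣q∣ (outside ∷ p) (outside ∷ q) = ∣p∪q∣≤∣p∣+∣q∣ p q
∣p∪q∣≤∣p∣+∣q∣ (inside  ∷ p) (outside ∷ q) = s≤s (∣p∪q∣≤∣p∣+∣q∣ p q)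
∣p∪q∣≤∣p∣+∣q∣ (outside ∷ p) (inside  ∷ q) =
  ℕ.≤-trans (s≤s (∣p∪q∣≤∣p∣+∣q∣ p q)) (ℕ.≤-reflexive (sym (ℕ.+-suc ∣ p ∣ ∣ q ∣)))
∣p∪q∣≤∣p∣+∣q∣ (inside  ∷ p) (inside  ∷ q) =
  s≤s (ℕ.≤-trans (∣p∪q∣≤∣p∣+∣q∣ p q) (ℕ.+-monoʳ-≤ ∣ p ∣ (ℕ.n≤1+n ∣ q ∣)))

disjoint⇒∣p∣+∣q∣≤∣r∣ : ∀ {n} {p q r : Subset n} → p ⊆ r → q ⊆ r →
                       (∀ {x} → x ∈ p → x ∉ q) → ∣ p ∣ + ∣ q ∣ ≤ ∣ r ∣
disjoint⇒∣p∣+∣q∣≤∣r∣ {p = p} {q} {r} p⊆r q⊆r disj =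
  ℕ.≤-trans (go p q disj) (p⊆q⇒∣p∣≤∣q∣ λ x∈ → [ p⊆r , q⊆r ]′ (x∈p∪q⁻ p q x∈))
  where
  go : ∀ {n} (p q : Subset n) → (∀ {x} → x ∈ p → x ∉ q) → ∣ p ∣ + ∣ q ∣ ≤ ∣ p ∪ q ∣
  go []            []            d = z≤n
  go (outside ∷ p) (outside ∷ q) d = go p q λ x∈p → d (there x∈p) ∘ there
  go (inside  ∷ p) (outside ∷ q) d = s≤s (go p q λ x∈p → d (there x∈p) ∘ there)
  go (outside ∷ p) (inside  ∷ q) d =
    ℕ.≤-trans (ℕ.≤-reflexive (ℕ.+-suc ∣ p ∣ ∣ q ∣)) (s≤s (go p q λ x∈p → d (there x∈p) ∘ there))
  go (inside  ∷ p) (inside  ∷ q) d = contradiction here (d here)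

remainder : ∀ {a b} c {d} → a + b ≤ c + d → d ≤ b → a ≤ c
remainder {a} c {d} a+b≤c+d d≤b =
  ℕ.+-cancelʳ-≤ d a c (ℕ.≤-trans (ℕ.+-monoʳ-≤ a d≤b) a+b≤c+d)

-- The value at `c` is the number of cats available in a round in which the mouse is on a vertex of
-- colour `c`.
Budget : Set
Budget = Bool → ℕ

bump : Bool → Budget → Budget
bump c β d = if does (d Bool.≟ c) then suc (β d) else β d

bump-bump-not : ∀ c r d → bump c (bump (not c) (const r)) d ≡ suc r
bump-bump-not false r false = refl
bump-bump-not false r true  = refl
bump-bump-not true  r false = refl
bump-bump-not true  r true  = refl

bump-not-bump : ∀ c r d → bump (not c) (bump c (const r)) d ≡ suc r
bump-not-bump false r false = refl
bump-not-bump false r true  = refl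
bump-not-bump true  r false = refl
bump-not-bump true  r true  = refl

β≤bump : ∀ c β d → β d ≤ bump c β d
β≤bump c β d with d Bool.≟ c
... | yes _ = ℕ.n≤1+n (β d)
... | no _  = ℕ.≤-refl

-- 1 + 4 + ⋯ + 4ʳ⁻¹ = (4ʳ − 1) / 3
threshold : ℕ → ℕ
threshold zero    = 0
threshold (suc r) = suc (4 * threshold r)

suc4m≡3m+[m+1] : ∀ m → suc (4 * m) ≡ m + m + m + suc m
suc4m≡3m+[m+1] = solve 1 (λ m → con 1 :+ con 4 :* m := m :+ m :+ m :+ (con 1 :+ m)) refl
  where open +-*-Solver

suc4m≡m+[3m+1] : ∀ m → suc (4 * m) ≡ m + (m + m + suc m)
suc4m≡m+[3m+1] = solve 1 (λ m → con 1 :+ con 4 :* m := m :+ (m :+ m :+ (con 1 :+ m))) refl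
  where open +-*-Solver

threshold-power : ∀ r → let M = threshold r in 4 ^ r ≡ M + M + suc M
threshold-power zero    = refl
threshold-power (suc r) = trans (cong (4 *_) (threshold-power r))
  (solve 1 (λ m → con 4 :* (m :+ m :+ (con 1 :+ m)) :=
    let k = con 1 :+ con 4 :* m in k :+ k :+ (con 1 :+ k)) refl (threshold r))
  where open +-*-Solver

n≤⌈n/2⌉+⌈n/2⌉ : ∀ n → n ≤ ⌈ n /2⌉ + ⌈ n /2⌉
n≤⌈n/2⌉+⌈n/2⌉ n = ℕ.≤-trans (ℕ.≤-reflexive (sym (ℕ.⌊n/2⌋+⌈n/2⌉≡n n)))
  (ℕ.+-monoˡ-≤ ⌈ n /2⌉ (ℕ.⌊n/2⌋≤⌈n/2⌉ n))

-- Stated for every accessibility proof, so that the induction can follow the recursion of `⌈log2⌉`.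
n≤2^⌈log2⌉n : ∀ n {acc} → n ≤ 2 ^ ⌈log2⌉ n acc
n≤2^⌈log2⌉n 0 = z≤n
n≤2^⌈log2⌉n 1 = ℕ.≤-refl
n≤2^⌈log2⌉n (suc (suc n)) {acc rs} = begin
  suc (suc n)                           ≤⟨ n≤⌈n/2⌉+⌈n/2⌉ (suc (suc n)) ⟩
  m + m                                 ≡⟨ cong (m +_) (ℕ.+-identityʳ m) ⟨
  2 * m                                 ≤⟨ ℕ.*-monoʳ-≤ 2 (n≤2^⌈log2⌉n m) ⟩
  2 ^ ⌈log2⌉ (suc (suc n)) (acc rs)     ∎
  where
  m = ⌈ suc (suc n) /2⌉
  open ℕ.≤-Reasoning

n≤4^⌈⌈log₂n⌉/2⌉ : ∀ n → n ≤ 4 ^ ⌈ ⌈log₂ n ⌉ /2⌉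
n≤4^⌈⌈log₂n⌉/2⌉ n = begin
  n                 ≤⟨ n≤2^⌈log2⌉n n ⟩
  2 ^ ⌈log₂ n ⌉     ≤⟨ ℕ.^-monoʳ-≤ 2 (n≤⌈n/2⌉+⌈n/2⌉ ⌈log₂ n ⌉) ⟩
  2 ^ (k + k)       ≡⟨ cong (λ j → 2 ^ (k + j)) (ℕ.+-identityʳ k) ⟨
  2 ^ (2 * k)       ≡⟨ ℕ.^-*-assoc 2 2 k ⟨
  4 ^ k             ∎
  where
  k = ⌈ ⌈log₂ n ⌉ /2⌉
  open ℕ.≤-Reasoning

-- Walks and paths that avoid a vertex.

module Avoiding {n : ℕ} (G : Graph n) (acyclic : ¬ Cycle G) where
  open Graph G

  ~⇒≢ : ∀ {x y} → x ~ y → x ≢ y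
  ~⇒≢ x~y x≡y = ~-irrefl x≡y x~y

  -- Excluding `v` at both ends makes `Walk v` reachability in T - v, except that the empty walk at
  -- `v` remains; hence the side conditions such as `b ≢ v` below.
  data Step (v x y : Fin n) : Set where
    move : x ≢ v → x ~ y → y ≢ v → Step v x y

  Walk : Fin n → Fin n → Fin n → Set
  Walk v = Star (Step v)

  reverseWalk : ∀ {v x y} → Walk v x y → Walk v y x
  reverseWalk = reverse λ { (move x≢v x~y y≢v) → move y≢v (~-sym x~y) x≢v }

  data Path (v b : Fin n) : Fin n → ∀ {k} → Vec (Fin n) (suc k) → Set where
    stop : b ≢ v → Path v b b (b ∷ [])
    step : ∀ {x y k} {ys : Vec (Fin n) (suc k)} →
           x ≢ v → x ~ y → x ∉ᵛ ys → Path v b y ys → Path v b x (x ∷ ys)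

  PathFrom : Fin n → Fin n → Fin n → Set
  PathFrom v b x = ∃₂ λ k (xs : Vec (Fin n) (suc k)) → Path v b x xs

  suffix : ∀ {v b x y k} {ys : Vec (Fin n) (suc k)} →
           Path v b y ys → x ∈ᵛ ys → PathFrom v b x
  suffix p@(stop _)       (here refl) = _ , _ , p
  suffix p@(step _ _ _ _) (here refl) = _ , _ , p
  suffix (step _ _ _ p)   (there x∈)  = suffix p x∈

  -- If the new first vertex already lies on the path found for the rest, the suffix starting there
  -- is taken instead.
  loopErase : ∀ {v x b} → b ≢ v → Walk v x b → PathFrom v b x
  loopErase b≢v ε = _ , _ , stop b≢v
  loopErase {x = x} b≢v (move x≢v x~y _ ◅ w) with loopErase b≢v w
  ... | _ , ys , p with DecMembership._∈?_ F._≟_ x ys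
  ...   | yes x∈ = suffix p x∈
  ...   | no  x∉ = _ , _ , step x≢v x~y x∉ p

  path-head : ∀ {v b x k} {xs : Vec (Fin n) (suc k)} →
              Path v b x xs → lookup xs zero ≡ x
  path-head (stop _)       = refl
  path-head (step _ _ _ _) = refl

  path-last : ∀ {v b x k} {xs : Vec (Fin n) (suc k)} →
              Path v b x xs → lookup xs (fromℕ k) ≡ b
  path-last (stop _)       = refl
  path-last (step _ _ _ p) = path-last p

  path-step : ∀ {v b x k} {xs : Vec (Fin n) (suc k)} → Path v b x xs →
              ∀ i → lookup xs (inject₁ i) ~ lookup xs (suc i)
  path-step (step _ x~y _ p) zero    = subst (_ ~_) (sym (path-head p)) x~y
  path-step (step _ _ _ p)   (suc i) = path-step p i

  path-unique : ∀ {v b x k} {xs : Vec (Fin n) (suc k)} →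
                Path v b x xs → Unique xs
  path-unique (stop _)        = [] ∷ []
  path-unique (step _ _ x∉ p) = ∉⇒All≢ x∉ ∷ path-unique p

  path-avoids : ∀ {v b x k} {xs : Vec (Fin n) (suc k)} →
                Path v b x xs → VecAll.All (v ≢_) xs
  path-avoids (stop b≢v)       = ≢-sym b≢v ∷ []
  path-avoids (step x≢v _ _ p) = ≢-sym x≢v ∷ path-avoids p

  -- The only direct use of acyclicity: a path from `a` to `b` in T - v with at least two vertices
  -- closes up through `v` to a cycle.
  unique-neighbour : ∀ {v a b} → v ~ a → v ~ b → Walk v a b → a ≡ b
  unique-neighbour {v} {a} {b} v~a v~b w
    with loopErase (≢-sym (~⇒≢ v~b)) w
  ... | zero  , _ , stop _ = refl
  ... | suc k , xs , p = contradiction cycle acyclic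
    where
    cycle : Cycle G
    cycle = record
      { k         = k
      ; vertex    = lookup (v ∷ xs)
      ; injective = lookup-injective (path-avoids p ∷ path-unique p) _ _
      ; step      = λ { zero    → subst (v ~_) (sym (path-head p)) v~a
                      ; (suc i) → path-step p i }
      ; close     = subst (_~ v) (sym (path-last p)) (~-sym v~b)
      }

  walk-start : ∀ {v x y} → y ≢ v → Walk v x y → x ≢ v
  walk-start y≢v ε                = y≢v
  walk-start _   (move x≢v _ _ ◅ _) = x≢v

  module _ {R : Rel (Fin n) 0ℓ} (R⇒~ : ∀ {x y} → R x y → x ~ y) where

    Exit : Fin n → Fin n → Set
    Exit v y = ∃ λ a → R v a × Walk v a y

    -- `R` is general because `hop-disjoint` cuts a walk that already avoids a second vertex and
    -- needs the exit step to avoid that vertex too.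
    cutAtLastVisit : ∀ {v x y} → y ≢ v → Star R x y → Walk v x y ⊎ Exit v y
    cutAtLastVisit y≢v ε = inj₁ ε
    cutAtLastVisit {v} {x} y≢v (xRz ◅ w) with cutAtLastVisit y≢v w
    ... | inj₂ e = inj₂ e
    ... | inj₁ w′ with x F.≟ v
    ...   | yes refl = inj₂ (_ , xRz , w′)
    ...   | no  x≢v  = inj₁ (move x≢v (R⇒~ xRz) (walk-start y≢v w′) ◅ w′)

    exit : ∀ {v y} → y ≢ v → Star R v y → Exit v y
    exit y≢v w with cutAtLastVisit y≢v w
    ... | inj₁ w′ = contradiction refl (walk-start y≢v w′)
    ... | inj₂ e  = e

  cutAtFirstVisit : ∀ {v x y} w → Walk v x y → Walk w x y ⊎ Walk v x w
  cutAtFirstVisit w ε = inj₁ ε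
  cutAtFirstVisit {x = x} w (s@(move _ x~z _) ◅ p)
    with x F.≟ w | cutAtFirstVisit w p
  ... | yes refl | _      = inj₂ ε
  ... | no _     | inj₂ q = inj₂ (s ◅ q)
  ... | no x≢w   | inj₁ q with _ F.≟ w
  ...   | yes z≡w = inj₂ (subst (Walk _ x) z≡w (s ◅ ε))
  ...   | no  z≢w = inj₁ (move x≢w x~z z≢w ◅ q)

-- Branches at a vertex of the tree.

module Routing {n : ℕ} (G : Graph n) (tree : IsTree G) where
  open Graph G
  open IsTree tree
  open Avoiding G acyclic

  abstract

    -- The first vertex after v on the way to x, with hop v v = v.
    hop : Fin n → Fin n → Fin n
    hop v x with x F.≟ v
    ... | yes _  = v
    ... | no x≢v = proj₁ (exit (λ e → e) x≢v (connected v x))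

    hop-self : ∀ v → hop v v ≡ v
    hop-self v with v F.≟ v
    ... | yes _  = refl
    ... | no v≢v = contradiction refl v≢v

    hop-walk : ∀ {v x} → x ≢ v → v ~ hop v x × Walk v (hop v x) x
    hop-walk {v} {x} x≢v with x F.≟ v
    ... | yes x≡v = contradiction x≡v x≢v
    ... | no  x≢v = proj₂ (exit (λ e → e) x≢v (connected v x))

  hop-adj : ∀ {v x} → x ≢ v → v ~ hop v x
  hop-adj = proj₁ ∘ hop-walk

  hop-fixed : ∀ {v x} → hop v x ≡ v → x ≡ v
  hop-fixed {v} {x} e = decidable-stable (x F.≟ v) λ x≢v →
    ~⇒≢ (hop-adj x≢v) (sym e)

  hop-unique : ∀ {v a x} → x ≢ v → v ~ a → Walk v a x → hop v x ≡ a
  hop-unique x≢v v~a w =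
    let v~h , p = hop-walk x≢v
    in unique-neighbour v~h v~a (p ◅◅ reverseWalk w)

  hop-neighbour : ∀ {v w} → v ~ w → hop v w ≡ w
  hop-neighbour v~w = hop-unique (≢-sym (~⇒≢ v~w)) v~w ε

  -- This is what confines the mouse: without stepping on `v` it cannot change its branch at `v`.
  hop-local : ∀ {v x y} → x ~ y → x ≢ v → y ≢ v → hop v x ≡ hop v y
  hop-local x~y x≢v y≢v =
    let v~h , p = hop-walk y≢v
    in hop-unique x≢v v~h (p ◅◅ move y≢v (~-sym x~y) x≢v ◅ ε)

  hop-≢ : ∀ {v w x} → v ~ w → hop v x ≡ w → x ≢ v
  hop-≢ v~w eq refl = ~⇒≢ v~w (trans (sym (hop-self _)) eq)

  -- Otherwise a walk from `v` to `x` avoiding `w` would leave `v` for the last time through a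
  -- neighbour other than `w`, which by `hop-unique` is `hop v x`. Together with `hop-cover`: the
  -- two sides of an edge partition the tree.
  hop-disjoint : ∀ {v w x} → v ~ w → hop v x ≡ w → hop w x ≢ v
  hop-disjoint {v} {w} {x} v~w refl wx≡v
    with exit (λ { (move _ x~y _) → x~y }) x≢v
           (subst (λ z → Walk w z x) wx≡v (proj₂ (hop-walk x≢w)))
    where
    x≢v = hop-≢ v~w refl
    x≢w = hop-≢ (~-sym v~w) wx≡v
  ... | a , move _ v~a a≢w , p = a≢w (sym (hop-unique (hop-≢ v~w refl) v~a p))

  -- Follow the walk from `hop v x` to `x` in T - v. If it avoids `w`, prefixing `v` shows that `x`
  -- lies behind `v` as seen from `w`; if it meets `w`, then `hop v x` and `w` are joined in T - v
  -- and so are equal.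
  hop-cover : ∀ {v w x} → v ~ w → hop v x ≢ w → hop w x ≡ v
  hop-cover {v} {w} {x} v~w vx≢w = case x F.≟ v of λ
    { (yes refl) → hop-neighbour (~-sym v~w)
    ; (no x≢v)   → turn x≢v (cutAtFirstVisit w (proj₂ (hop-walk x≢v))) }
    where
    x≢w : x ≢ w
    x≢w refl = vx≢w (hop-neighbour v~w)

    turn : x ≢ v → Walk w (hop v x) x ⊎ Walk v (hop v x) w → hop w x ≡ v
    turn x≢v (inj₁ q) =
      hop-unique x≢w (~-sym v~w) (move (~⇒≢ v~w) (hop-adj x≢v) vx≢w ◅ q)
    turn x≢v (inj₂ q) =
      contradiction (unique-neighbour (hop-adj x≢v) v~w q) vx≢w

-- A proper two-colouring.

module Colouring {n : ℕ} (G : Graph n) (tree : IsTree G) where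
  open Graph G
  open IsTree tree renaming (nonempty to root)
  open Avoiding G acyclic using (~⇒≢)
  open Routing G tree

  -- False exactly at the vertices other than the root on the path from the root
  -- to x, so its parity differs from that of the depth of x by a constant.
  offPath : Fin n → Fin n → Bool
  offPath x v = does (v F.≟ root) ∨ does (hop v x F.≟ hop v root)

  colour : Fin n → Bool
  colour x = parity (offPath x)

  -- Here `y` is the parent of `x`, so the paths from the root to the two differ only in `x`.
  colour-child : ∀ {x y} → x ~ y → hop x root ≡ y → colour x ≡ not (colour y)
  colour-child {x} {y} x~y xr≡y = parity-flip x flip same
    where
    flip : offPath x x ≡ not (offPath y x)
    flip with x F.≟ root
    ... | yes refl = contradiction refl (hop-≢ x~y xr≡y)
    ... | no  _ = trans
      (dec-false (_ F.≟ _) λ e → ~⇒≢ x~y (trans (sym (hop-self x)) (trans e xr≡y)))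
      (cong not (sym (dec-true (_ F.≟ _) (trans (hop-neighbour x~y) (sym xr≡y)))))

    same : ∀ v → v ≢ x → offPath x v ≡ offPath y v
    same v v≢x with v F.≟ root | v F.≟ y
    ... | yes _ | _ = refl
    ... | no _ | no v≢y =
      cong (λ z → does (z F.≟ hop v root)) (hop-local x~y (≢-sym v≢x) (≢-sym v≢y))
    ... | no v≢r | yes refl = trans
      (dec-false (_ F.≟ _) λ e → hop-disjoint x~y xr≡y
         (trans (sym e) (hop-neighbour (~-sym x~y))))
      (sym (dec-false (_ F.≟ _) λ e → v≢r
         (sym (hop-fixed (trans (sym e) (hop-self v))))))

  colour-proper : ∀ {x y} → x ~ y → colour x ≡ not (colour y)
  colour-proper {x} {y} x~y with hop x root F.≟ y
  ... | yes e = colour-child x~y e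
  ... | no ¬e = trans (sym (Bool.not-involutive _))
    (cong not (sym (colour-child (~-sym x~y) (hop-cover x~y ¬e))))

-- Rounds, guards and confined play.

module Pursuit {n : ℕ} (G : Graph n) (tree : IsTree G) where
  open Graph G
  open IsTree tree renaming (nonempty to root)
  open Avoiding G acyclic using (~⇒≢)
  open Routing G tree
  open Colouring G tree using (colour; colour-proper)

  Side : Fin n → Fin n → Subset n
  Side v w = comprehension (λ x → hop v x F.≟ w)

  ∈-Side⁺ : ∀ {v w x} → hop v x ≡ w → x ∈ Side v w
  ∈-Side⁺ = ∈-comprehension⁺ (λ x → hop _ x F.≟ _)

  ∈-Side⁻ : ∀ {v w x} → x ∈ Side v w → hop v x ≡ w
  ∈-Side⁻ = ∈-comprehension⁻ (λ x → hop _ x F.≟ _)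

  -- The mouse is at a vertex of colour c only in every other round, so in any
  -- given round only one of the two sets is actually played.
  Round : Set
  Round = Bool → Subset n

  Legal : Budget → Round → Set
  Legal β ρ = ∀ c → ∣ ρ c ∣ ≤ β c

  idle : Round
  idle _ = ⊥

  idle-legal : ∀ {β} → Legal β idle
  idle-legal c = ℕ.≤-trans (ℕ.≤-reflexive (∣⊥∣≡0 n)) z≤n

  guard : Fin n → Round → Round
  guard v ρ d = if does (d Bool.≟ colour v) then ρ d ∪ ⁅ v ⁆ else ρ d

  guard-legal : ∀ {v β ρ} → Legal β ρ → Legal (bump (colour v) β) (guard v ρ)
  guard-legal {v} {β} {ρ} legal d with d Bool.≟ colour v
  ... | no _  = legal d
  ... | yes _ = begin
    ∣ ρ d ∪ ⁅ v ⁆ ∣      ≤⟨ ∣p∪q∣≤∣p∣+∣q∣ (ρ d) ⁅ v ⁆ ⟩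
    ∣ ρ d ∣ + ∣ ⁅ v ⁆ ∣  ≡⟨ cong (∣ ρ d ∣ +_) (∣⁅x⁆∣≡1 v) ⟩
    ∣ ρ d ∣ + 1          ≡⟨ ℕ.+-comm ∣ ρ d ∣ 1 ⟩
    suc ∣ ρ d ∣          ≤⟨ s≤s (legal d) ⟩
    suc (β d)            ∎
    where open ℕ.≤-Reasoning

  guard-catches : ∀ {v ρ x} → x ∉ guard v ρ (colour x) → x ≢ v × x ∉ ρ (colour x)
  guard-catches {v} {ρ} {x} x∉ with colour x Bool.≟ colour v
  ... | no ¬e = (λ { refl → ¬e refl }) , x∉
  ... | yes _ = (λ { refl → x∉ (q⊆p∪q (ρ (colour v)) ⁅ v ⁆ (x∈⁅x⁆ v)) }) , x∉ ∘ p⊆p∪q ⁅ v ⁆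

  -- Only positions after the first are tested against `R` and the cats; `Wins` adds that the start
  -- lies in `R`.
  data Play (R : Subset n) : List Round → Fin n → Fin n → Set where
    []   : ∀ {x} → Play R [] x x
    step : ∀ {ρ σ x y z} → x ~ y → y ∈ R → y ∉ ρ (colour y) →
           Play R σ y z → Play R (ρ ∷ σ) x z

  play-split : ∀ {R} σ {τ x z} → Play R (σ ++ τ) x z →
               ∃ λ y → Play R σ x y × Play R τ y z
  play-split []      p = _ , [] , p
  play-split (ρ ∷ σ) (step x~y y∈R y∉ p) =
    let y , q , r = play-split σ p in y , step x~y y∈R y∉ q , r

  play-stays : ∀ {R σ x y} → x ∈ R → Play R σ x y → y ∈ R
  play-stays x∈R []                 = x∈R
  play-stays _   (step _ y∈R _ p) = play-stays y∈R p

  Wins : Budget → Subset n → Set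
  Wins β R = ∃ λ σ → All (Legal β) σ × (∀ {x y} → x ∈ R → ¬ Play R σ x y)

  legal-mono : ∀ {β γ σ} → (∀ c → β c ≤ γ c) → All (Legal β) σ → All (Legal γ) σ
  legal-mono β≤γ = All.map λ legal c → ℕ.≤-trans (legal c) (β≤γ c)

  Wins-mono : ∀ {β γ R} → (∀ c → β c ≤ γ c) → Wins β R → Wins γ R
  Wins-mono β≤γ (σ , legal , win) = σ , legal-mono β≤γ legal , win

  -- By `hop-local` a guard on `v` holds the mouse in its branch, so the play is one of `σ` alone in
  -- a smaller region.
  guarded-play : ∀ {R v w x y} σ → x ≢ v → hop v x ≡ w →
                 Play R (map (guard v) σ) x y →
                 y ≢ v × hop v y ≡ w × Play (R ∩ Side v w) σ x y
  guarded-play []      x≢v x∈ [] = x≢v , x∈ , []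
  guarded-play {v = v} {w} (ρ ∷ σ) x≢v x∈ (step x~y y∈R y∉ p) =
    let y≢v , y∉ρ = guard-catches {ρ = ρ} y∉
        y∈ = trans (sym (hop-local x~y x≢v y≢v)) x∈
        z≢v , z∈ , q = guarded-play σ y≢v y∈ p
    in z≢v , z∈ , step x~y (x∈p∩q⁺ (y∈R , ∈-Side⁺ y∈)) y∉ρ q

  module _ {β : Budget} {M : ℕ} (small : ∀ R → ∣ R ∣ ≤ M → Wins β R)
           (v : Fin n) (R : Subset n) where

    -- Each light branch is cleaned by its own winning strategy under a guard on `v`; heavy ones are
    -- skipped. Since the mouse never changes branch, surviving the list forces its branch, if
    -- listed, to be heavy.
    clean-among : ∀ (ws : List (Fin n)) → ∃ λ τ → All (Legal (bump (colour v) β)) τ ×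
      (∀ {x y} → x ∈ R → x ≢ v → Play R τ x y →
        y ≢ v × hop v y ≡ hop v x ×
        (hop v x ∈ˡ ws → M < ∣ R ∩ Side v (hop v x) ∣))
    clean-among [] = [] , [] , λ { _ x≢v [] → x≢v , refl , λ () }
    clean-among (w ∷ ws) with clean-among ws | ∣ R ∩ Side v w ∣ ℕ.≤? M
    ... | τ , legal , clean | no big = τ , legal , λ x∈R x≢v p →
      let y≢v , same , rest = clean x∈R x≢v p
      in y≢v , same , λ { (here refl) → ℕ.≰⇒> big ; (there u∈) → rest u∈ }
    ... | τ , legal , clean | yes light with small (R ∩ Side v w) light
    ...   | σ , legal′ , win =
      map (guard v) σ ++ τ ,
      All.++⁺ (All.map⁺ (All.map (λ {ρ} → guard-legal {ρ = ρ}) legal′)) legal ,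
      λ {x} x∈R x≢v p →
        let y , p₁ , p₂ = play-split (map (guard v) σ) p
            y≢v , y∼x , q = guarded-play σ x≢v refl p₁
            z≢v , z∼y , rest = clean (play-stays x∈R p₁) y≢v p₂
        in z≢v , trans z∼y y∼x , λ
          { (here refl) → contradiction q (win (x∈p∩q⁺ (x∈R , ∈-Side⁺ refl)))
          ; (there u∈)  → subst (λ u → u ∈ˡ ws → M < ∣ R ∩ Side v u ∣) y∼x rest u∈ }

    clean : ∃ λ τ → All (Legal (bump (colour v) β)) τ ×
      (∀ {x y} → x ∈ R → x ≢ v → Play R τ x y →
        y ≢ v × hop v y ≡ hop v x × M < ∣ R ∩ Side v (hop v x) ∣)
    clean with clean-among (allFin n)
    ... | τ , legal , c = τ , legal , λ x∈R x≢v p →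
      let y≢v , same , big = c x∈R x≢v p in y≢v , same , big (∈-allFin _)

    guard-wins : (∀ w → v ~ w → ∣ R ∩ Side v w ∣ ≤ M) → Wins (bump (colour v) β) R
    -- The extra first round ensures that the mouse is not on `v`, as `clean` requires.
    guard-wins light with clean
    ... | τ , legal , c = guard v idle ∷ τ , guard-legal {ρ = idle} idle-legal ∷ legal , λ
      { x∈R (step x~y y∈R y∉ p) →
          let y≢v , _ = guard-catches {ρ = idle} y∉
              _ , _ , big = c y∈R y≢v p
          in ℕ.<⇒≱ big (light _ (hop-adj y≢v)) }

  -- Heavy sides of edges.

  Heavy : ℕ → Subset n → Fin n → Fin n → Set
  Heavy M R v w = v ~ w × M < ∣ R ∩ Side v w ∣

  heavy? : ∀ M R v w → Dec (Heavy M R v w)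
  heavy? M R v w = (v ~? w) ×-dec (M ℕ.<? ∣ R ∩ Side v w ∣)

  ¬heavy⇒light : ∀ {M} R {v w} → v ~ w → ¬ Heavy M R v w → ∣ R ∩ Side v w ∣ ≤ M
  ¬heavy⇒light R v~w ¬heavy = ℕ.≮⇒≥ λ big → ¬heavy (v~w , big)

  ∩-monoʳ-⊆ : ∀ R {P Q : Subset n} → P ⊆ Q → R ∩ P ⊆ R ∩ Q
  ∩-monoʳ-⊆ R P⊆Q x∈ = let x∈R , x∈P = x∈p∩q⁻ R _ x∈ in x∈p∩q⁺ (x∈R , P⊆Q x∈P)

  Side-child-⊆ : ∀ {p q w} → p ~ q → w ≢ p → Side q w ⊆ Side p q
  Side-child-⊆ {p} {q} p~q w≢p {x} x∈ with hop p x F.≟ q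
  ... | yes e = ∈-Side⁺ e
  ... | no ¬e = contradiction (trans (sym (∈-Side⁻ x∈)) (hop-cover p~q ¬e)) w≢p

  -- The vertex `q` is lost. Sizes are taken without intersecting with `R`, since `q` may lie
  -- outside `R`; this is the termination measure of `climb` and `sweep`.
  Side-child-< : ∀ {p q w} → p ~ q → q ~ w → w ≢ p → ∣ Side q w ∣ < ∣ Side p q ∣
  Side-child-< {p} {q} {w} p~q q~w w≢p = p⊂q⇒∣p∣<∣q∣
    ( Side-child-⊆ p~q w≢p , q , ∈-Side⁺ (hop-neighbour p~q)
    , λ q∈ → ~⇒≢ q~w (trans (sym (hop-self q)) (∈-Side⁻ q∈)) )

  sides-disjoint : ∀ R {v w w′} → w ≢ w′ → ∀ {x} → x ∈ R ∩ Side v w → x ∉ R ∩ Side v w′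
  sides-disjoint R w≢w′ x∈ x∈′ = w≢w′ (trans
    (sym (∈-Side⁻ (proj₂ (x∈p∩q⁻ R _ x∈)))) (∈-Side⁻ (proj₂ (x∈p∩q⁻ R _ x∈′))))

  ∣opposite-sides∣ : ∀ R {p q} → p ~ q → ∣ R ∩ Side p q ∣ + ∣ R ∩ Side q p ∣ ≤ ∣ R ∣
  ∣opposite-sides∣ R {p} {q} p~q =
    disjoint⇒∣p∣+∣q∣≤∣r∣ (p∩q⊆p R _) (p∩q⊆p R _) λ x∈ x∈′ →
      hop-disjoint p~q (∈-Side⁻ (proj₂ (x∈p∩q⁻ R _ x∈)))
                       (∈-Side⁻ (proj₂ (x∈p∩q⁻ R _ x∈′)))

  Peak : ℕ → Subset n → Set
  Peak M R = ∃₂ λ q p → Heavy M R q p ×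
    (∀ w → p ~ w → w ≢ q → ∣ R ∩ Side p w ∣ ≤ M)

  climb : ∀ {M} R fuel {q p} → ∣ Side q p ∣ < fuel → Heavy M R q p → Peak M R
  climb {M} R (suc fuel) {q} {p} (s≤s bound) heavy
    with F.any? (λ w → heavy? M R p w ×-dec ¬? (w F.≟ q))
  ... | yes (w , heavy′ , w≢q) =
    climb R fuel (ℕ.<-≤-trans (Side-child-< (proj₁ heavy) (proj₁ heavy′) w≢q) bound) heavy′
  ... | no none = q , p , heavy , λ w p~w w≢q →
    ¬heavy⇒light R p~w λ heavy′ → none (w , heavy′ , w≢q)

  light-or-peak : ∀ M R → (∀ v w → v ~ w → ∣ R ∩ Side v w ∣ ≤ M) ⊎ Peak M R
  light-or-peak M R with F.any? (λ v → F.any? (heavy? M R v))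
  ... | yes (v , w , heavy) = inj₂ (climb R (suc ∣ Side v w ∣) ℕ.≤-refl heavy)
  ... | no none = inj₁ λ v w v~w → ¬heavy⇒light R v~w λ heavy → none (v , w , heavy)

  -- Adjacent vertices have opposite colours, so guarding both costs one cat of each colour.
  bump-adjacent : ∀ {p q} r → p ~ q → ∀ c → bump (colour p) (bump (colour q) (const 0)) c ≤ suc r
  bump-adjacent {p} {q} r p~q c = begin
    bump (colour p) (bump (colour q) (const 0)) c
      ≡⟨ cong (λ d → bump (colour p) (bump d (const 0)) c) (colour-proper (~-sym p~q)) ⟩
    bump (colour p) (bump (not (colour p)) (const 0)) c
      ≡⟨ bump-bump-not (colour p) 0 c ⟩
    1
      ≤⟨ s≤s z≤n ⟩
    suc r ∎
    where open ℕ.≤-Reasoning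

  -- The step to equally many cats of both colours.

  module _ {r M : ℕ} (small : ∀ c R → ∣ R ∣ ≤ M → Wins (bump c (const r)) R)
           (R : Subset n) where

    -- The guard takes one cat of the colour of `v`; the remaining budget has its surplus in the
    -- opposite colour.
    cleanBalanced : ∀ v → ∃ λ τ → All (Legal (const (suc r))) τ ×
      (∀ {x y} → x ∈ R → x ≢ v → Play R τ x y →
        y ≢ v × hop v y ≡ hop v x × M < ∣ R ∩ Side v (hop v x) ∣)
    cleanBalanced v =
      let τ , legal , c = clean (small (not (colour v))) v R
      in τ , legal-mono (ℕ.≤-reflexive ∘ bump-bump-not (colour v) r) legal , c

    -- Guarding both p and q for one round hands the guard over without letting the
    -- mouse slip past.
    advance : ∀ {p q} → p ~ q → ∃ λ τ → All (Legal (const (suc r))) τ ×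
      (∀ {x y} → x ∈ R → hop p x ≡ q → Play R τ x y →
        y ∈ R × hop q y ≢ p × Heavy M R q (hop q y))
    advance {p} {q} p~q with cleanBalanced q
    ... | τ , legal , c = both ∷ τ , both-legal ∷ legal , λ
      { x∈R x∈ (step x~y y∈R y∉ play) →
          let y≢p , y∉′ = guard-catches {p} {guard q idle} y∉
              y≢q , _   = guard-catches {q} {idle} y∉′
              z≢q , z∼y , big = c y∈R y≢q play
              y∈ = trans (sym (hop-local x~y (hop-≢ p~q x∈) y≢p)) x∈
          in play-stays y∈R play
           -- The handover round left the mouse on the side of `q`, and its branch at `q` has not
           -- changed since.
           , (λ e → hop-disjoint p~q y∈ (trans (sym z∼y) e))
           , hop-adj z≢q
           , subst (λ u → M < ∣ R ∩ Side q u ∣) (sym z∼y) big }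
      where
      both : Round
      both = guard p (guard q idle)

      both-legal : Legal (const (suc r)) both
      both-legal d = ℕ.≤-trans
        (guard-legal {p} {bump (colour q) (const 0)} {guard q idle}
          (guard-legal {q} {const 0} {idle} idle-legal) d)
        (bump-adjacent r p~q d)

    -- Two heavy branches ahead would be disjoint parts of `R ∩ Side p q` with at least 2M + 2
    -- vertices in all.
    heavy-unique : ∀ {p q w u} → ∣ R ∩ Side p q ∣ ≤ M + M → p ~ q →
                   w ≢ p → Heavy M R q w → u ≢ p → Heavy M R q u → w ≡ u
    heavy-unique {p} {q} {w} {u} atMost p~q w≢p (_ , bigw) u≢p (_ , bigu) =
      decidable-stable (w F.≟ u) λ w≢u → ℕ.<⇒≱ (ℕ.+-mono-< bigw bigu)
        (ℕ.≤-trans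
          (disjoint⇒∣p∣+∣q∣≤∣r∣ (∩-monoʳ-⊆ R (Side-child-⊆ p~q w≢p))
            (∩-monoʳ-⊆ R (Side-child-⊆ p~q u≢p)) (sides-disjoint R w≢u))
          atMost)

    -- The bound 2M passes to the heavy branch ahead because sides nest, so `heavy-unique` applies
    -- again after each handover.
    sweep : ∀ fuel {p q} → ∣ Side p q ∣ < fuel → p ~ q → ∣ R ∩ Side p q ∣ ≤ M + M →
            ∃ λ σ → All (Legal (const (suc r))) σ ×
              (∀ {x y} → x ∈ R → hop p x ≡ q → ¬ Play R σ x y)
    sweep (suc fuel) {p} {q} (s≤s bound) p~q atMost
      with advance p~q | F.any? (λ w → heavy? M R q w ×-dec ¬? (w F.≟ p))
    ... | τ , legal , reach | no none = τ , legal , λ x∈R x∈ play →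
      let _ , u≢p , heavy = reach x∈R x∈ play in none (_ , heavy , u≢p)
    ... | τ , legal , reach | yes (w , heavy , w≢p)
      with sweep fuel (ℕ.<-≤-trans (Side-child-< p~q (proj₁ heavy) w≢p) bound)
             (proj₁ heavy)
             (ℕ.≤-trans (p⊆q⇒∣p∣≤∣q∣ (∩-monoʳ-⊆ R (Side-child-⊆ p~q w≢p))) atMost)
    ...   | σ , legal′ , win = τ ++ σ , All.++⁺ legal legal′ , λ x∈R x∈ play →
      let z , play₁ , play₂ = play-split τ play
          z∈R , u≢p , heavy′ = reach x∈R x∈ play₁
      in win z∈R (heavy-unique atMost p~q u≢p heavy′ w≢p heavy) play₂

    peak-wins : Peak M R → ∣ R ∣ ≤ M + M + suc M → Wins (const (suc r)) R
    peak-wins (q , p , (q~p , big) , light) bound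
      with cleanBalanced p
         | sweep (suc ∣ Side p q ∣) ℕ.≤-refl (~-sym q~p)
             -- The heavy side holds at least M + 1 of at most 3M + 1 vertices, leaving 2M for the
             -- other.
             (remainder (M + M) (ℕ.≤-trans (∣opposite-sides∣ R (~-sym q~p)) bound) big)
    ... | τ , legal , c | σ , legal′ , win =
      guard p idle ∷ τ ++ σ ,
      guard-idle-legal ∷ All.++⁺ legal legal′ , λ
      { x∈R (step _ y∈R y∉ play) →
          let y≢p , _ = guard-catches {p} {idle} y∉
              z , play₁ , play₂ = play-split τ play
              z≢p , z∼y , heavy = c y∈R y≢p play₁
              y→q = decidable-stable (_ F.≟ q) λ y↛q →
                ℕ.<⇒≱ heavy (light _ (hop-adj y≢p) y↛q)
          in win (play-stays y∈R play₁) (trans z∼y y→q) play₂ }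
      where
      guard-idle-legal : Legal (const (suc r)) (guard p idle)
      guard-idle-legal d = ℕ.≤-trans
        (guard-legal {p} {bump (not (colour p)) (const r)} {idle} idle-legal d)
        (ℕ.≤-reflexive (bump-bump-not (colour p) r d))

    balanced-step : ∣ R ∣ ≤ M + M + suc M → Wins (const (suc r)) R
    balanced-step bound with light-or-peak M R
    ... | inj₂ peak  = peak-wins peak bound
    -- Without heavy sides any vertex can be guarded; the root is taken.
    ... | inj₁ light = Wins-mono (ℕ.≤-reflexive ∘ bump-bump-not (colour root) r)
      (guard-wins (small (not (colour root))) root R (light root))

  -- The step with a surplus cat, and the joint induction.

  Balanced : ℕ → Set
  Balanced r = let M = threshold r in
    ∀ R → ∣ R ∣ ≤ M + M + suc M → Wins (const r) R

  -- The bound is the M of `Balanced (suc r)`, so these are the strategies that clean light branches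
  -- there.
  Unbalanced : ℕ → Set
  Unbalanced r = ∀ c R → ∣ R ∣ ≤ threshold (suc r) → Wins (bump c (const r)) R

  -- The mouse has to move within `R`, which takes two vertices; one round without cats suffices.
  singleton-wins : ∀ {β R} → ∣ R ∣ ≤ 1 → Wins β R
  singleton-wins {R = R} bound = idle ∷ [] , idle-legal ∷ [] , λ
    { {x} x∈R (step {y = y} x~y y∈R _ _) → ℕ.<⇒≱ (s≤s (s≤s z≤n)) (begin
        2                       ≡⟨ cong₂ _+_ (∣⁅x⁆∣≡1 x) (∣⁅x⁆∣≡1 y) ⟨
        ∣ ⁅ x ⁆ ∣ + ∣ ⁅ y ⁆ ∣   ≤⟨ disjoint⇒∣p∣+∣q∣≤∣r∣
                                     (λ z∈ → subst (_∈ R) (sym (x∈⁅y⁆⇒x≡y x z∈)) x∈R)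
                                     (λ z∈ → subst (_∈ R) (sym (x∈⁅y⁆⇒x≡y y z∈)) y∈R)
                                     (λ z∈x z∈y → ~⇒≢ x~y (trans
                                       (sym (x∈⁅y⁆⇒x≡y x z∈x)) (x∈⁅y⁆⇒x≡y y z∈y))) ⟩
        ∣ R ∣                   ≤⟨ bound ⟩
        1                       ∎) }
    where open ℕ.≤-Reasoning

  module _ {r : ℕ} (balanced : Balanced (suc r)) (unbalanced : Unbalanced r)
           (c : Bool) (R : Subset n) where

    private
      M = threshold (suc r)

    -- The surplus cat is the guard, leaving `suc r` cats of each colour for branches of up to 3M +
    -- 1 vertices.
    guard-same : ∀ v → colour v ≡ c →
      (∀ w → v ~ w → ∣ R ∩ Side v w ∣ ≤ M + M + suc M) →
      Wins (bump c (const (suc r))) R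
    guard-same v refl = guard-wins balanced v R

    guard-other : ∀ v → colour v ≡ not c →
      (∀ w → v ~ w → ∣ R ∩ Side v w ∣ ≤ M) → Wins (bump c (const (suc r))) R
    guard-other v v≡ light =
      Wins-mono {bump (colour v) (bump c (const r))} enough
        (guard-wins {bump c (const r)} (unbalanced c) v R light)
      where
      enough : ∀ d → bump (colour v) (bump c (const r)) d ≤ bump c (const (suc r)) d
      enough d = begin
        bump (colour v) (bump c (const r)) d ≡⟨ cong (λ e → bump e (bump c (const r)) d) v≡ ⟩
        bump (not c) (bump c (const r)) d    ≡⟨ bump-not-bump c r d ⟩
        suc r                                ≤⟨ β≤bump c (const (suc r)) d ⟩
        bump c (const (suc r)) d             ∎
        where open ℕ.≤-Reasoning

    M≤3M : M ≤ M + M + suc M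
    M≤3M = ℕ.≤-trans (ℕ.n≤1+n M) (ℕ.m≤n+m (suc M) (M + M))

    -- The heavy side takes M + 1 of at most 4M + 1 vertices, so at most 3M remain.
    far-side : ∀ {p q} → q ~ p → M < ∣ R ∩ Side q p ∣ → ∣ R ∣ ≤ threshold (suc (suc r)) →
               ∣ R ∩ Side p q ∣ ≤ M + M + suc M
    far-side q~p big bound = ℕ.≤-trans
      (remainder (M + M + M)
        (ℕ.≤-trans (∣opposite-sides∣ R (~-sym q~p))
          (ℕ.≤-trans bound (ℕ.≤-reflexive (suc4m≡3m+[m+1] M))))
        big)
      (ℕ.+-monoʳ-≤ (M + M) (ℕ.n≤1+n M))

    unbalanced-step : ∣ R ∣ ≤ threshold (suc (suc r)) → Wins (bump c (const (suc r))) R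
    unbalanced-step bound with light-or-peak M R
    unbalanced-step bound | inj₁ light with colour root Bool.≟ c
    ... | yes e = guard-same root e λ w root~w → ℕ.≤-trans (light root w root~w) M≤3M
    ... | no ¬e = guard-other root (Bool.¬-not ¬e) (light root)
    unbalanced-step bound | inj₂ (q , p , (q~p , big) , light)
      with colour p Bool.≟ c | ∣ R ∩ Side q p ∣ ℕ.≤? M + M + suc M
    ... | yes e | _ = guard-same p e λ w p~w → case w F.≟ q of λ
      { (yes refl) → far≤3M
      ; (no w≢q)   → ℕ.≤-trans (light w p~w w≢q) M≤3M }
      where
      far≤3M = far-side q~p big bound
    -- Now `q` has colour `c`; its branches other than that of `p` lie inside the far side.
    ... | no ¬e | yes near≤3M = guard-same q colour-q λ w q~w → case w F.≟ p of λ
      { (yes refl) → near≤3M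
      ; (no w≢p)   → ℕ.≤-trans
          (p⊆q⇒∣p∣≤∣q∣ (∩-monoʳ-⊆ R (Side-child-⊆ (~-sym q~p) w≢p)))
          (far-side q~p big bound) }
      where
      colour-q : colour q ≡ c
      colour-q = trans (colour-proper q~p)
        (trans (cong not (Bool.¬-not ¬e)) (Bool.not-involutive c))
    -- The near side exceeds 3M + 1, so the far side has at most M vertices and all branches at `p`
    -- are light.
    ... | no ¬e | no ¬near≤3M = guard-other p (Bool.¬-not ¬e) λ w p~w → case w F.≟ q of λ
      { (yes refl) → remainder M
          (ℕ.≤-trans (∣opposite-sides∣ R p~w)
            (ℕ.≤-trans bound (ℕ.≤-reflexive (suc4m≡m+[3m+1] M))))
          (ℕ.<⇒≤ (ℕ.≰⇒> ¬near≤3M))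
      ; (no w≢q) → light w p~w w≢q }

  mutual

    balanced : ∀ r → Balanced r
    balanced zero    R = singleton-wins
    balanced (suc r) R = balanced-step (unbalanced r) R

    unbalanced : ∀ r → Unbalanced r
    unbalanced zero    c R = singleton-wins
    unbalanced (suc r) c R = unbalanced-step (balanced (suc r)) (unbalanced r) c R

  -- From coloured rounds to a strategy.

  -- `c` is the colour assumed for the mouse before the first round; hence `not c` is the one to
  -- play.
  schedule : Bool → List Round → List (Subset n)
  schedule c []      = []
  schedule c (ρ ∷ σ) = ρ (not c) ∷ schedule (not c) σ

  finalColour : Bool → List Round → Bool
  finalColour c []      = c
  finalColour c (ρ ∷ σ) = finalColour (not c) σ

  schedule-bounded : ∀ {k σ} c → All (Legal (const k)) σ → All (λ S → ∣ S ∣ ≤ k) (schedule c σ)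
  schedule-bounded c []              = []
  schedule-bounded c (legal ∷ legals) = legal (not c) ∷ schedule-bounded (not c) legals

  data Evasion : List (Subset n) → Fin n → Fin n → Set where
    []   : ∀ {x} → Evasion [] x x
    step : ∀ {C σ x y z} → x ~ y → y ∉ C → Evasion σ y z → Evasion (C ∷ σ) x z

  evasion-split : ∀ σ {τ x z} → Evasion (σ ++ τ) x z →
                  ∃ λ y → Evasion σ x y × Evasion τ y z
  evasion-split []      e = _ , [] , e
  evasion-split (C ∷ σ) (step x~y y∉ e) =
    let y , e₁ , e₂ = evasion-split σ e in y , step x~y y∉ e₁ , e₂

  evasion⇒play : ∀ {c x y} σ → colour x ≡ c → Evasion (schedule c σ) x y → Play ⊤ σ x y
  evasion⇒play []      _  []                = []
  evasion⇒play {c} {x} (ρ ∷ σ) xc (step {y = y} x~y y∉ e) =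
    step x~y ∈⊤ (subst (λ d → y ∉ ρ d) (sym yc) y∉) (evasion⇒play σ yc e)
    where
    yc : colour y ≡ not c
    yc = trans (colour-proper (~-sym x~y)) (cong not xc)

  -- `d` may differ from `c`: colours alternate even when the schedule was built for the wrong one,
  -- so the colour after the first run is known.
  evasion-colour : ∀ {c d x y} σ → colour x ≡ d → Evasion (schedule c σ) x y →
                   colour y ≡ finalColour d σ
  evasion-colour []      xd []               = xd
  evasion-colour (ρ ∷ σ) xd (step x~y _ e) =
    evasion-colour σ (trans (colour-proper (~-sym x~y)) (cong not xd)) e

  caught-or-evades : ∀ {x} σ (v : Vec (Fin n) (length σ)) → Linked _~_ (x ∷ v) →
    (∃ λ i → Vec.lookup v i ∈ Vec.lookup (Vec.fromList σ) i) ⊎ ∃ (Evasion σ x)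
  caught-or-evades []      []      _         = inj₂ (_ , [])
  caught-or-evades (C ∷ σ) (y ∷ v) (x~y ∷ l) with y ∈? C
  ... | yes y∈ = inj₁ (zero , y∈)
  ... | no  y∉ with caught-or-evades σ v l
  ...   | inj₁ (i , p) = inj₁ (suc i , p)
  ...   | inj₂ (z , e) = inj₂ (z , step x~y y∉ e)

  Wins⇒CatWin : ∀ {r} → Wins (const r) ⊤ → CatWin G r
  Wins⇒CatWin {r} (σ , legal , win) =
    suc (length full) , ⊥ ∷ Vec.fromList full ,
    ℕ.≤-trans (ℕ.≤-reflexive (∣⊥∣≡0 n)) z≤n VecAll.∷
      VecAll.fromList⁺ (All.++⁺ (schedule-bounded false legal) (schedule-bounded second legal)) ,
    catches
    where
    -- One run of σ for a mouse that starts at colour false, then one for a mouse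
    -- that starts at colour true; Play does not check the starting vertex, hence
    -- the empty first round.
    second = finalColour true σ
    full = schedule false σ ++ schedule second σ

    no-evasion : ∀ {x z} c → colour x ≡ c → ¬ Evasion full x z
    no-evasion false xc e =
      let _ , e₁ , _ = evasion-split (schedule false σ) e
      in win ∈⊤ (evasion⇒play σ xc e₁)
    no-evasion true xc e =
      let _ , e₁ , e₂ = evasion-split (schedule false σ) e
      in win ∈⊤ (evasion⇒play σ (evasion-colour σ xc e₁) e₂)

    catches : Catches G (⊥ ∷ Vec.fromList full)
    catches (x ∷ v) l with caught-or-evades full v l
    ... | inj₁ (i , p) = suc i , p
    ... | inj₂ (_ , e) = contradiction e (no-evasion (colour x) refl)

theorem1p4 : ∀ (n : ℕ) (T : Graph n) → IsTree T → h T ≤ ⌈ ⌈log₂ n ⌉ /2⌉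
theorem1p4 n T tree = proj₂ (h-isLeast T) r (Wins⇒CatWin (balanced r ⊤ bound))
  where
  open Pursuit T tree
  r = ⌈ ⌈log₂ n ⌉ /2⌉
  bound : ∣ ⊤ {n} ∣ ≤ threshold r + threshold r + suc (threshold r)
  bound = ℕ.≤-trans (ℕ.≤-reflexive (∣⊤∣≡n n))
    (ℕ.≤-trans (n≤4^⌈⌈log₂n⌉/2⌉ n) (ℕ.≤-reflexive (threshold-power r)))
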